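{- For every transposition sequence $\langle s_1,\ldots,s_m\rangle$ over $\mathbf{S}_n$, its dual is $$\left\langle s_1,\; s_2^{\,s_1},\; s_3^{\,s_2 s_1},\;\ldots,\; s_m^{\,s_{m-1}\cdots s_1}\right\rangle .$$
   Context: $\mathbf{S}_n$ is the symmetric group on $[n]=\{1,\ldots,n\}$; permutations are multiplied from left to right (in $p\cdot q$, $p$ is applied first). A transposition sequence over $\mathbf{S}_n$ is a finite sequence of transpositions of $\mathbf{S}_n$. For permutations $p,t$, $p^{t}$ denotes the conjugate $t^{ -1}pt$. Dual (Mind-Body Dual): A Mind-Body Assignment over $n$ is a permutation $A\in\mathbf{S}_n$, thought of as mapping each mind $M$ to the body $A(M)$; one says $M$ is above $A(M)$. For a transposition $(x,y)$, the body-swapping operation turns $A$ into the assignment in which the bodies $x$ and $y$ are exchanged (the mind that was above $x$ is now above $y$ and vice versa; all else unchanged). Given $\mathbf{s}=\langle s_1,\ldots,s_m\rangle$, let $A_0$ be the identity and let $A_k$ be the result of applying to $A_{k-1}$ the body-swapping operation with $s_k$. The dual of $\mathbf{s}$ is $\langle s_1',\ldots,s_m'\rangle$, where, if $s_k=(x,y)$, then $s_k'=(x',y')$ with $x'$ above $x$ and $y'$ above $y$ in $A_{k-1}$. -}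

module Defs where

open import Data.Fin.Base using (Fin; toℕ)
open import Data.Fin.Permutation using (Permutation′; permutation; _⟨$⟩ʳ_; _⟨$⟩ˡ_; inverseˡ; inverseʳ; id; flip; _∘ₚ_; transpose)
open import Data.Fin.Properties using (_≟_)
open import Data.List.Base using (List; []; _∷_; map; foldr; take; reverse; tabulate; lookup; length)
open import Data.Nat.Base using (ℕ)
open import Function.Definitions using (StrictlyInverseˡ; StrictlyInverseʳ)
open import Relation.Binary.PropositionalEquality using (_≡_; _≢_; refl; sym; trans; cong)
open import Relation.Nullary using (yes; no; contradiction)

-- The transposition (x , y), presented by an ordered pair of distinct points.
-- The presentations (x , y) and (y , x) are only identified after
-- applying ⟦_⟧, up to equality _≈_ of permutations.
record Transposition (n : ℕ) : Set where
  constructor ⟨_,_∣_⟩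
  field
    x y : Fin n
    x≢y : x ≢ y

open Transposition

⟦_⟧ : ∀ {n} → Transposition n → Permutation′ n
⟦ ⟨ x , y ∣ _ ⟩ ⟧ = transpose x y

-- The library's p ∘ₚ q applies p first, so it is the left-to-right product
-- p · q.
infixl 10 _^_

_^_ : ∀ {n} → Permutation′ n → Permutation′ n → Permutation′ n
p ^ t = flip t ∘ₚ p ∘ₚ t

product : ∀ {n} → List (Permutation′ n) → Permutation′ n
product = foldr _∘ₚ_ id

-- A sends each mind M to the body A ⟨$⟩ʳ M; M is above that body.
Assignment : ℕ → Set
Assignment = Permutation′

mindAbove : ∀ {n} → Assignment n → Fin n → Fin n
mindAbove A b = A ⟨$⟩ˡ b

bodySwap : ∀ {n} → Transposition n → Assignment n → Assignment n
bodySwap {n} ⟨ x , y ∣ x≢y ⟩ A = permutation to from to∘from from∘to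
  where
  to : Fin n → Fin n
  to M with A ⟨$⟩ʳ M ≟ x | A ⟨$⟩ʳ M ≟ y
  ... | yes _ | _     = y
  ... | no  _ | yes _ = x
  ... | no  _ | no  _ = A ⟨$⟩ʳ M

  from : Fin n → Fin n
  from b with b ≟ x | b ≟ y
  ... | yes _ | _     = mindAbove A y
  ... | no  _ | yes _ = mindAbove A x
  ... | no  _ | no  _ = mindAbove A b

  to-x : ∀ {M} → A ⟨$⟩ʳ M ≡ x → to M ≡ y
  to-x {M} e with A ⟨$⟩ʳ M ≟ x | A ⟨$⟩ʳ M ≟ y
  ... | yes _ | _ = refl
  ... | no ¬e | _ = contradiction e ¬e

  to-y : ∀ {M} → A ⟨$⟩ʳ M ≡ y → to M ≡ x
  to-y {M} e with A ⟨$⟩ʳ M ≟ x | A ⟨$⟩ʳ M ≟ y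
  ... | yes f | _     = contradiction (trans (sym f) e) x≢y
  ... | no  _ | yes _ = refl
  ... | no  _ | no ¬e = contradiction e ¬e

  to-other : ∀ {M} → A ⟨$⟩ʳ M ≢ x → A ⟨$⟩ʳ M ≢ y → to M ≡ A ⟨$⟩ʳ M
  to-other {M} ¬e ¬f with A ⟨$⟩ʳ M ≟ x | A ⟨$⟩ʳ M ≟ y
  ... | yes e | _     = contradiction e ¬e
  ... | no  _ | yes f = contradiction f ¬f
  ... | no  _ | no  _ = refl

  from-x : ∀ {b} → b ≡ x → from b ≡ mindAbove A y
  from-x {b} e with b ≟ x | b ≟ y
  ... | yes _ | _ = refl
  ... | no ¬e | _ = contradiction e ¬e

  from-y : ∀ {b} → b ≡ y → from b ≡ mindAbove A x
  from-y {b} e with b ≟ x | b ≟ y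
  ... | yes f | _     = contradiction (trans (sym f) e) x≢y
  ... | no  _ | yes _ = refl
  ... | no  _ | no ¬e = contradiction e ¬e

  from-other : ∀ {b} → b ≢ x → b ≢ y → from b ≡ mindAbove A b
  from-other {b} ¬e ¬f with b ≟ x | b ≟ y
  ... | yes e | _     = contradiction e ¬e
  ... | no  _ | yes f = contradiction f ¬f
  ... | no  _ | no  _ = refl

  to∘from : StrictlyInverseˡ _≡_ to from
  to∘from b with b ≟ x | b ≟ y
  ... | yes e | _     = trans (to-y (inverseʳ A)) (sym e)
  ... | no  _ | yes f = trans (to-x (inverseʳ A)) (sym f)
  ... | no ¬e | no ¬f = trans
    (to-other (λ e → ¬e (trans (sym (inverseʳ A)) e))
              (λ f → ¬f (trans (sym (inverseʳ A)) f)))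
    (inverseʳ A)

  from∘to : StrictlyInverseʳ _≡_ to from
  from∘to M with A ⟨$⟩ʳ M ≟ x | A ⟨$⟩ʳ M ≟ y
  ... | yes e | _     = trans (from-y refl) (trans (cong (mindAbove A) (sym e)) (inverseˡ A))
  ... | no  _ | yes f = trans (from-x refl) (trans (cong (mindAbove A) (sym f)) (inverseˡ A))
  ... | no ¬e | no ¬f = trans (from-other ¬e ¬f) (inverseˡ A)

mindsAbove : ∀ {n} → Assignment n → Transposition n → Transposition n
mindsAbove A ⟨ x , y ∣ x≢y ⟩ = ⟨ mindAbove A x , mindAbove A y ∣ x′≢y′ ⟩
  where
  x′≢y′ : mindAbove A x ≢ mindAbove A y
  x′≢y′ e = x≢y (trans (sym (inverseʳ A)) (trans (cong (A ⟨$⟩ʳ_) e) (inverseʳ A)))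

-- The argument A is the assignment in force before the first remaining swap.
dualFrom : ∀ {n} → Assignment n → List (Transposition n) → List (Transposition n)
dualFrom A []       = []
dualFrom A (s ∷ ss) = mindsAbove A s ∷ dualFrom (bodySwap s A) ss

dual : ∀ {n} → List (Transposition n) → List (Transposition n)
dual = dualFrom id

-- Indices start at 0: the entry at index k is sₖ₊₁ conjugated by sₖ ⋯ s₁.
-- At index 0 the exponent is the empty product, so that entry is s₁.
conjugates : ∀ {n} → List (Transposition n) → List (Permutation′ n)
conjugates s = tabulate {n = length s} λ k →
  ⟦ lookup s k ⟧ ^ product (reverse (map ⟦_⟧ (take (toℕ k) s)))

{-# OPTIONS --safe #-}
-- Bodies start out as A₀ = id, and swapping the bodies of s is right
-- multiplication by s, so A_{k-1} = s₁ ⋯ s_{k-1}.  Its inverse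
-- s_{k-1} ⋯ s₁ takes each body to the mind above it, and conjugating the
-- transposition (x , y) by t yields (t x , t y).
module Submission where

open import Defs
open import Data.Fin.Base using (Fin; toℕ)
open import Data.Fin.Permutation using (Permutation′; _≈_; _⟨$⟩ʳ_; _⟨$⟩ˡ_; inverseʳ; id; flip; _∘ₚ_; transpose)
open import Data.Fin.Properties using (_≟_)
open import Data.List.Base using (List; []; _∷_; map; foldr; take; reverse; tabulate; lookup)
open import Data.List.Properties using (foldr-∷ʳ; tabulate-cong; unfold-reverse)
open import Data.List.Relation.Binary.Pointwise.Base using (Pointwise; []; _∷_)
open import Data.Nat.Base using (ℕ)
open import Function.Base using (_∘_)
open import Function.Bundles using (Injection)
open import Function.Definitions using (Injective)
open import Function.Properties.Inverse using (↔⇒↣)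
open import Relation.Binary.PropositionalEquality using (_≡_; refl; sym; trans; cong; subst)
open import Relation.Nullary using (yes; no)
open import Relation.Nullary.Decidable using (dec-true; dec-false)

-- Injectivity makes the tests of `f j` against `f x` and `f y` come out like those of `j` against
-- `x` and `y`, so both sides take the same branch.
transpose-equivariant : ∀ {n} (f : Fin n → Fin n) → Injective _≡_ _≡_ f → ∀ x y j →
  transpose (f x) (f y) ⟨$⟩ʳ f j ≡ f (transpose x y ⟨$⟩ʳ j)
transpose-equivariant f inj x y j with j ≟ x
... | yes refl rewrite dec-true (f j ≟ f j) refl = refl
... | no j≢x rewrite dec-false (f j ≟ f x) (j≢x ∘ inj) with j ≟ y
...   | yes refl rewrite dec-true (f j ≟ f j) refl = refl
...   | no j≢y rewrite dec-false (f j ≟ f y) (j≢y ∘ inj) = refl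

transpose-^ : ∀ {n} (t : Permutation′ n) x y →
  transpose (t ⟨$⟩ʳ x) (t ⟨$⟩ʳ y) ≈ transpose x y ^ t
transpose-^ t x y i = trans
  -- Write `i` as the image under `t` of its preimage, so that equivariance applies.
  (cong (transpose (t ⟨$⟩ʳ x) (t ⟨$⟩ʳ y) ⟨$⟩ʳ_) (sym (inverseʳ t)))
  (transpose-equivariant (t ⟨$⟩ʳ_) (Injection.injective (↔⇒↣ t)) x y (t ⟨$⟩ˡ i))

mindsAbove-^ : ∀ {n} (A : Assignment n) (t : Permutation′ n) → t ≈ flip A → ∀ s →
  ⟦ mindsAbove A s ⟧ ≈ ⟦ s ⟧ ^ t
mindsAbove-^ A t t≈A⁻¹ ⟨ x , y ∣ _ ⟩ i
  rewrite sym (t≈A⁻¹ x) | sym (t≈A⁻¹ y) = transpose-^ t x y i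

-- The mind above `b` after the swap is the one that was above the partner of `b` before it.
flip-bodySwap : ∀ {n} (s : Transposition n) (A : Assignment n) →
  ⟦ s ⟧ ∘ₚ flip A ≈ flip (bodySwap s A)
flip-bodySwap ⟨ x , y ∣ _ ⟩ A b with b ≟ x
... | yes _ = refl
... | no  _ with b ≟ y
...   | yes _ = refl
...   | no  _ = refl

-- Reversal puts `x` last, next to the base of the fold, which can absorb it.
foldr-reverse-∷ : ∀ {a b} {A : Set a} {B : Set b} (f : A → B → B) e x xs →
  foldr f e (reverse (x ∷ xs)) ≡ foldr f (f x e) (reverse xs)
foldr-reverse-∷ f e x xs =
  trans (cong (foldr f e) (unfold-reverse x xs)) (foldr-∷ʳ f e x (reverse xs))

-- The base t of the fold stands for the inverse of the product of the swaps
-- already made.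
dualFrom-conjugates : ∀ {n} (A : Assignment n) (t : Permutation′ n) → t ≈ flip A → ∀ s →
  Pointwise _≈_ (map ⟦_⟧ (dualFrom A s))
    (tabulate λ k → ⟦ lookup s k ⟧ ^ foldr _∘ₚ_ t (reverse (map ⟦_⟧ (take (toℕ k) s))))
dualFrom-conjugates A t t≈A⁻¹ []       = []
dualFrom-conjugates A t t≈A⁻¹ (s ∷ ss) =
  mindsAbove-^ A t t≈A⁻¹ s ∷
  -- The induction hypothesis carries `s` in its base, whereas the goal has it at the end of each
  -- reversed prefix.
  subst (Pointwise _≈_ _)
    (tabulate-cong λ k → cong (⟦ lookup ss k ⟧ ^_)
      (sym (foldr-reverse-∷ _∘ₚ_ t ⟦ s ⟧ (map ⟦_⟧ (take (toℕ k) ss)))))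
    (dualFrom-conjugates (bodySwap s A) (⟦ s ⟧ ∘ₚ t)
      (λ b → trans (t≈A⁻¹ (⟦ s ⟧ ⟨$⟩ʳ b)) (flip-bodySwap s A b)) ss)

theorem5p5 : (n : ℕ) (s : List (Transposition n)) → Pointwise _≈_ (map ⟦_⟧ (dual s)) (conjugates s)
-- With base `id` the fold is `product`.
theorem5p5 n s = dualFrom-conjugates id id (λ _ → refl) s
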